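{- Let $\mathcal C$ and $\mathcal D$ be wild categories, let $L:\mathcal C\to\mathcal D$ and $R:\mathcal D\to\mathcal C$ be wild functors, and let $(\psi,\mathsf{nat}_{cod},\mathsf{nat}_{dom}) : L\dashv R$ be a wild adjunction. Let $\Gamma$ be a graph, $F$ a $\Gamma$-shaped diagram in $\mathcal C$, and $\mathcal K=(C,r,K)$ a colimiting cocone under $F$. If $L$ is $2$-coherent, then the cocone $L(\mathcal K)$ under $L(F)$ is colimiting.
   Context: Everything is inside Martin-Löf type theory with function extensionality (Book HoTT conventions); $=$ is the identity type, $p\cdot q$ is path concatenation, $\mathsf{ap}_f$ is the action of $f$ on paths. Wild category: a type $\mathsf{Ob}$ of objects, a family $\mathsf{hom}:\mathsf{Ob}\to\mathsf{Ob}\to\mathcal V$ of types (not assumed to be sets), identities $\mathsf{id}$, composition $\circ$, left and right unit laws (paths), and an associativity law $\mathsf{assoc}(f,g,h):(f\circ g)\circ h=f\circ(g\circ h)$. No further coherence is required. Wild functor $F:\mathcal C\to\mathcal D$: a function on objects, a function on morphisms, paths $F_\circ(g,f):F(g)\circ F(f)=F(g\circ f)$ and $F_{\mathsf{id}}(X):\mathsf{id}_{F(X)}=F(\mathsf{id}_X)$. Wild adjunction $L\dashv R$ (for $L:\mathcal C\to\mathcal D$, $R:\mathcal D\to\mathcal C$): a family of equivalences $\psi:\mathsf{hom}_{\mathcal D}(L(A),X)\simeq\mathsf{hom}_{\mathcal C}(A,R(X))$ with paths $\mathsf{nat}_{cod}(g,h):R(g)\circ\psi(h)=\psi(g\circ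 h)$ for $g:\mathsf{hom}_{\mathcal D}(X,Y)$, $h:\mathsf{hom}_{\mathcal D}(L(A),X)$, and $\mathsf{nat}_{dom}(f,h):\psi(h)\circ f=\psi(h\circ L(f))$ for $f:\mathsf{hom}_{\mathcal C}(A,B)$, $h:\mathsf{hom}_{\mathcal D}(L(B),Y)$. $2$-coherence: given such an adjunction, $L$ is $2$-coherent if for all $h_1:\mathsf{hom}_{\mathcal D}(L(X),Y)$, $h_2:\mathsf{hom}_{\mathcal C}(Z,X)$, $h_3:\mathsf{hom}_{\mathcal C}(W,Z)$ the following two paths from $(\psi(h_1)\circ h_2)\circ h_3$ to $\psi(h_1\circ(L(h_2)\circ L(h_3)))$ are equal: $$\mathsf{assoc}(\psi(h_1),h_2,h_3)\cdot\mathsf{nat}_{dom}(h_2\circ h_3,h_1)\cdot\mathsf{ap}_\psi(\mathsf{ap}_{h_1\circ- }(L_\circ(h_2,h_3)))^{ -1}$$ and $$\mathsf{ap}_{ -\circ h_3}(\mathsf{nat}_{dom}(h_2,h_1))\cdot\mathsf{nat}_{dom}(h_3,h_1\circ L(h_2))\cdot\mathsf{ap}_\psi(\mathsf{assoc}(h_1,L(h_2),L(h_3))).$$ Graph $\Gamma$: a type $\Gamma_0$ of vertices and a family $\Gamma_1:\Gamma_0\to\Gamma_0\to\mathcal U$ of edges. A $\Gamma$-shaped diagram $F$ in $\mathcal C$: objects $F_i$ for $i:\Gamma_0$ and morphisms $F_{i,j,g}:\mathsf{hom}_{\mathcal C}(F_i,F_j)$ for $g:\Gamma_1(i,j)$.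 A cocone $\mathcal K=(C,r,K)$ under $F$: an object $C$, morphisms $r_i:\mathsf{hom}_{\mathcal C}(F_i,C)$ and paths $K_{i,j,g}:r_j\circ F_{i,j,g}=r_i$. Write $\mathsf{lim}_{i:\Gamma^{op}}\mathsf{hom}_{\mathcal C}(F_i,X):=\sum_{s:\prod_i\mathsf{hom}_{\mathcal C}(F_i,X)}\prod_{i,j,g:\Gamma_1(i,j)}s_j\circ F_{i,j,g}=s_i$. The cocone $\mathcal K$ is colimiting if for every object $X$ the map $\mathsf{hom}_{\mathcal C}(C,X)\to\mathsf{lim}_{i:\Gamma^{op}}\mathsf{hom}_{\mathcal C}(F_i,X)$, $f\mapsto(\lambda i.\,f\circ r_i,\ \mathsf{assoc}(f,r_j,F_{i,j,g})\cdot\mathsf{ap}_{f\circ- }(K_{i,j,g}))$, is an equivalence. For a wild functor $L$, $L(F)$ is the diagram with $L(F)_i=L(F_i)$, $L(F)_{i,j,g}=L(F_{i,j,g})$, and $L(\mathcal K)$ is the cocone $(L(C),\ L(r_i),\ L_\circ(r_j,F_{i,j,g})\cdot\mathsf{ap}_L(K_{i,j,g}))$ under $L(F)$. -}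

{-# OPTIONS --without-K #-}
-- Axiom K is off: hom-types need not be sets, and equalities between paths
-- carry content.
module Defs where

open import Level using (Level; _⊔_) renaming (suc to lsuc)
open import Data.Product.Base using (Σ-syntax; _,_)
open import Function.Properties.Inverse.HalfAdjointEquivalence using (_≃_)
open import Relation.Binary.PropositionalEquality.Core using (_≡_; cong; sym; trans)

private
  variable
    a b o h o′ h′ v e : Level

infixl 5 _∙_

_∙_ : {A : Set a} {x y z : A} → x ≡ y → y ≡ z → x ≡ z
p ∙ q = trans p q

-- The property of a map of being a half adjoint equivalence; the fields are
-- those of the library's _≃_ other than the underlying map.
record IsEquiv {A : Set a} {B : Set b} (f : A → B) : Set (a ⊔ b) where
  field
    from             : B → A
    left-inverse-of  : ∀ x → from (f x) ≡ x
    right-inverse-of : ∀ y → f (from y) ≡ y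
    left-right       : ∀ x → cong f (left-inverse-of x) ≡ right-inverse-of (f x)

≃⇒isEquiv : {A : Set a} {B : Set b} (w : A ≃ B) → IsEquiv (_≃_.to w)
≃⇒isEquiv w = record { _≃_ w }

isEquiv⇒≃ : {A : Set a} {B : Set b} {f : A → B} → IsEquiv f → A ≃ B
isEquiv⇒≃ {f = f} w = record { to = f ; IsEquiv w }

record WildCategory (o h : Level) : Set (lsuc (o ⊔ h)) where
  infixr 9 _∘_
  field
    Ob    : Set o
    hom   : Ob → Ob → Set h
    id    : ∀ X → hom X X
    _∘_   : ∀ {X Y Z} → hom Y Z → hom X Y → hom X Z
    idˡ   : ∀ {X Y} (f : hom X Y) → id Y ∘ f ≡ f
    idʳ   : ∀ {X Y} (f : hom X Y) → f ∘ id X ≡ f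
    assoc : ∀ {W X Y Z} (f : hom Y Z) (g : hom X Y) (k : hom W X) →
            (f ∘ g) ∘ k ≡ f ∘ (g ∘ k)

record WildFunctor (𝒞 : WildCategory o h) (𝒟 : WildCategory o′ h′) :
                   Set (o ⊔ h ⊔ o′ ⊔ h′) where
  private
    module 𝒞 = WildCategory 𝒞
    module 𝒟 = WildCategory 𝒟
  field
    F₀   : 𝒞.Ob → 𝒟.Ob
    F₁   : ∀ {X Y} → 𝒞.hom X Y → 𝒟.hom (F₀ X) (F₀ Y)
    F-∘  : ∀ {X Y Z} (g : 𝒞.hom Y Z) (f : 𝒞.hom X Y) →
           F₁ g 𝒟.∘ F₁ f ≡ F₁ (g 𝒞.∘ f)
    F-id : ∀ X → 𝒟.id (F₀ X) ≡ F₁ (𝒞.id X)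

record WildAdjunction {𝒞 : WildCategory o h} {𝒟 : WildCategory o′ h′}
                      (L : WildFunctor 𝒞 𝒟) (R : WildFunctor 𝒟 𝒞) :
                      Set (o ⊔ h ⊔ o′ ⊔ h′) where
  private
    module 𝒞 = WildCategory 𝒞
    module 𝒟 = WildCategory 𝒟
    module L = WildFunctor L
    module R = WildFunctor R
  field
    ψ-equiv : ∀ A X → 𝒟.hom (L.F₀ A) X ≃ 𝒞.hom A (R.F₀ X)

  ψ : ∀ {A X} → 𝒟.hom (L.F₀ A) X → 𝒞.hom A (R.F₀ X)
  ψ {A} {X} = _≃_.to (ψ-equiv A X)

  field
    nat-cod : ∀ {A X Y} (g : 𝒟.hom X Y) (k : 𝒟.hom (L.F₀ A) X) →
              R.F₁ g 𝒞.∘ ψ k ≡ ψ (g 𝒟.∘ k)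
    nat-dom : ∀ {A B Y} (f : 𝒞.hom A B) (k : 𝒟.hom (L.F₀ B) Y) →
              ψ k 𝒞.∘ f ≡ ψ (k 𝒟.∘ L.F₁ f)

Is2Coherent : {𝒞 : WildCategory o h} {𝒟 : WildCategory o′ h′}
              {L : WildFunctor 𝒞 𝒟} {R : WildFunctor 𝒟 𝒞} →
              WildAdjunction L R → Set (o ⊔ h ⊔ o′ ⊔ h′)
Is2Coherent {𝒞 = 𝒞} {𝒟 = 𝒟} {L = L} adj =
  ∀ {X Y Z W} (h₁ : 𝒟.hom (L.F₀ X) Y) (h₂ : 𝒞.hom Z X) (h₃ : 𝒞.hom W Z) →
    𝒞.assoc (ψ h₁) h₂ h₃
      ∙ nat-dom (h₂ 𝒞.∘ h₃) h₁
      ∙ sym (cong ψ (cong (h₁ 𝒟.∘_) (L.F-∘ h₂ h₃)))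
  ≡ cong (𝒞._∘ h₃) (nat-dom h₂ h₁)
      ∙ nat-dom h₃ (h₁ 𝒟.∘ L.F₁ h₂)
      ∙ cong ψ (𝒟.assoc h₁ (L.F₁ h₂) (L.F₁ h₃))
  where
  module 𝒞 = WildCategory 𝒞
  module 𝒟 = WildCategory 𝒟
  module L = WildFunctor L
  open WildAdjunction adj

record Graph (v e : Level) : Set (lsuc (v ⊔ e)) where
  field
    Γ₀ : Set v
    Γ₁ : Γ₀ → Γ₀ → Set e

record Diagram (Γ : Graph v e) (𝒞 : WildCategory o h) :
               Set (v ⊔ e ⊔ o ⊔ h) where
  open Graph Γ
  open WildCategory 𝒞
  field
    D₀ : Γ₀ → Ob
    D₁ : ∀ {i j} → Γ₁ i j → hom (D₀ i) (D₀ j)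

record Cocone {Γ : Graph v e} {𝒞 : WildCategory o h} (F : Diagram Γ 𝒞) :
              Set (v ⊔ e ⊔ o ⊔ h) where
  open Graph Γ
  open WildCategory 𝒞
  open Diagram F
  field
    tip : Ob
    leg : ∀ i → hom (D₀ i) tip
    tri : ∀ {i j} (g : Γ₁ i j) → leg j ∘ D₁ g ≡ leg i

-- lim_{i : Γᵒᵖ} hom (F i) X
LimHom : {Γ : Graph v e} {𝒞 : WildCategory o h} (F : Diagram Γ 𝒞) →
         WildCategory.Ob 𝒞 → Set (v ⊔ e ⊔ h)
LimHom {Γ = Γ} {𝒞 = 𝒞} F X =
  Σ[ s ∈ (∀ i → hom (D₀ i) X) ]
    (∀ i j (g : Γ₁ i j) → s j ∘ D₁ g ≡ s i)
  where
  open Graph Γ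
  open WildCategory 𝒞
  open Diagram F

postcompose : {Γ : Graph v e} {𝒞 : WildCategory o h} {F : Diagram Γ 𝒞}
              (K : Cocone F) (X : WildCategory.Ob 𝒞) →
              WildCategory.hom 𝒞 (Cocone.tip K) X → LimHom F X
postcompose {𝒞 = 𝒞} {F = F} K X f =
    (λ i → f ∘ leg i)
  , (λ i j g → assoc f (leg j) (D₁ g) ∙ cong (f ∘_) (tri g))
  where
  open WildCategory 𝒞
  open Diagram F
  open Cocone K

IsColimiting : {Γ : Graph v e} {𝒞 : WildCategory o h} {F : Diagram Γ 𝒞} →
               Cocone F → Set (v ⊔ e ⊔ o ⊔ h)
IsColimiting {𝒞 = 𝒞} K = ∀ (X : WildCategory.Ob 𝒞) → IsEquiv (postcompose K X)

module _ {𝒞 : WildCategory o h} {𝒟 : WildCategory o′ h′}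
         (L : WildFunctor 𝒞 𝒟) {Γ : Graph v e} where

  private
    module L = WildFunctor L

  mapDiagram : Diagram Γ 𝒞 → Diagram Γ 𝒟
  mapDiagram F = record
    { D₀ = λ i → L.F₀ (D₀ i)
    ; D₁ = λ g → L.F₁ (D₁ g)
    }
    where open Diagram F

  mapCocone : {F : Diagram Γ 𝒞} → Cocone F → Cocone (mapDiagram F)
  mapCocone {F} K = record
    { tip = L.F₀ tip
    ; leg = λ i → L.F₁ (leg i)
    ; tri = λ {i} {j} g → L.F-∘ (leg j) (D₁ g) ∙ cong L.F₁ (tri g)
    }
    where
    open Diagram F
    open Cocone K

{-# OPTIONS --safe #-}
{-# OPTIONS --without-K #-}
-- The equivalences ψ and the paths nat-dom transpose each matching family from
-- L(F) to X into one from F to R(X). 2-coherence of L makes this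
-- transposition carry postcomposition with L(K) to postcomposition with K:
--
--   hom (L C) X  →  lim hom (L(F) i) X
--        | ψ             | transpose
--   hom C (R X)  →  lim hom (F i) (R X)
--
-- The left and bottom maps are equivalences, so an inverse of the top map only
-- needs transpose to be injective. That follows from ψ being fully faithful on
-- paths, once paths of matching families are described by homotopies of their
-- components.
module Submission where

open import Defs
open import Level using (Level; _⊔_)
open import Axiom.Extensionality.Propositional using (Extensionality)
open import Data.Product.Base using (Σ-syntax; _,_; proj₁; proj₂)
open import Function.Base using (_∘′_)
open import Function.Bundles using (mk↔ₛ′)
open import Function.Properties.Inverse.HalfAdjointEquivalence using (_≃_; ↔⇒≃)
open import Relation.Binary.PropositionalEquality
  using (_≡_; refl; cong; cong₂; sym; trans; subst; cong-∘; sym-cong; trans-cong;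
         trans-reflʳ; trans-injectiveʳ; module ≡-Reasoning)

private
  variable
    a b o h o′ h′ v e : Level

-- A pair `(g , H)` is one function into the based path types of the points `f x`. Each such type
-- contracts to `(f x , refl)`, so `ext` gives a path of functions along which `base` is
-- transported.
homotopy-induction :
  Extensionality a b →
  ∀ {p} {A : Set a} {B : A → Set b} {f : ∀ x → B x}
  (P : (g : ∀ x → B x) → (∀ x → f x ≡ g x) → Set p) →
  P f (λ _ → refl) →
  ∀ {g} (H : ∀ x → f x ≡ g x) → P g H
homotopy-induction ext {f = f} P base {g} H =
  subst (λ s → P (λ x → proj₁ (s x)) (λ x → proj₂ (s x))) singletons-≡ base
  where
  singletons-≡ : (λ x → f x , refl) ≡ (λ x → g x , H x)
  singletons-≡ = ext (λ x → based-path (H x))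
    where
    based-path : ∀ {A : Set b} {x y : A} (p : x ≡ y) →
                 _≡_ {A = Σ[ z ∈ A ] x ≡ z} (x , refl) (y , p)
    based-path refl = refl

conjugate-≡ : {A : Set a} {f : A → A} (H : ∀ x → f x ≡ x) →
              ∀ {x y} (p : x ≡ y) → sym (H x) ∙ (cong f p ∙ H y) ≡ p
conjugate-≡ H {x} refl = sym-cancel (H x)
  where
  sym-cancel : ∀ {A : Set a} {x y : A} (p : x ≡ y) → sym p ∙ p ≡ refl
  sym-cancel refl = refl

module _ {A : Set a} {B : Set b} (w : A ≃ B) where

  open _≃_ w

  reflect : ∀ {x y} → to x ≡ to y → x ≡ y
  reflect {x} {y} q =
    sym (left-inverse-of x) ∙ (cong from q ∙ left-inverse-of y)

  reflect-cong : ∀ {x y} (p : x ≡ y) → reflect (cong to p) ≡ p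
  reflect-cong {x} {y} p =
    trans (cong (λ q → sym (left-inverse-of x) ∙ (q ∙ left-inverse-of y))
                (sym (cong-∘ p)))
          (conjugate-≡ left-inverse-of p)

  -- The half adjoint law `left-right` turns the image under `to` of a conjugation by
  -- `left-inverse-of` into a conjugation by `right-inverse-of`, which naturality removes.
  cong-reflect : ∀ {x y} (q : to x ≡ to y) → cong to (reflect q) ≡ q
  cong-reflect {x} {y} q = begin
    cong to (sym (left-inverse-of x) ∙ (cong from q ∙ left-inverse-of y))
      ≡⟨ trans-cong (sym (left-inverse-of x)) ⟨
    cong to (sym (left-inverse-of x)) ∙ cong to (cong from q ∙ left-inverse-of y)
      ≡⟨ cong₂ _∙_ (sym-cong (left-inverse-of x)) (trans-cong (cong from q)) ⟨
    sym (cong to (left-inverse-of x)) ∙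
      (cong to (cong from q) ∙ cong to (left-inverse-of y))
      ≡⟨ cong₂ (λ r s → sym r ∙ (cong to (cong from q) ∙ s))
               (left-right x) (left-right y) ⟩
    sym (right-inverse-of (to x)) ∙
      (cong to (cong from q) ∙ right-inverse-of (to y))
      ≡⟨ cong (λ r → sym (right-inverse-of (to x)) ∙ (r ∙ right-inverse-of (to y)))
              (cong-∘ q) ⟨
    sym (right-inverse-of (to x)) ∙
      (cong (to ∘′ from) q ∙ right-inverse-of (to y))
      ≡⟨ conjugate-≡ right-inverse-of q ⟩
    q ∎
    where open ≡-Reasoning

  cong-to-injective : ∀ {x y} {p q : x ≡ y} → cong to p ≡ cong to q → p ≡ q
  cong-to-injective {p = p} {q} eq =
    trans (sym (reflect-cong p)) (trans (cong reflect eq) (reflect-cong q))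

module _ {Γ : Graph v e} {𝒞 : WildCategory o h} (F : Diagram Γ 𝒞)
         {X : WildCategory.Ob 𝒞} where

  open Graph Γ
  open WildCategory 𝒞
  open Diagram F

  -- The squares express transport of `σ` along `p` without `subst`, so that path algebra suffices
  -- to check them.
  _≈_ : LimHom F X → LimHom F X → Set (v ⊔ e ⊔ h)
  (s , σ) ≈ (t , τ) =
    Σ[ p ∈ (∀ i → s i ≡ t i) ]
      (∀ i j (g : Γ₁ i j) → σ i j g ∙ p i ≡ cong (_∘ D₁ g) (p j) ∙ τ i j g)

  ≡⇒≈ : ∀ {x y} → x ≡ y → x ≈ y
  ≡⇒≈ {s , σ} refl = (λ i → refl) , (λ i j g → trans-reflʳ (σ i j g))

  ≈⇒≡ : (∀ a b → Extensionality a b) → ∀ {x y} → x ≈ y → x ≡ y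
  ≈⇒≡ ext {s , σ} {t , τ} (p , sq) =
    homotopy-induction (ext _ _)
      -- The motive quantifies over `τ` and its squares because their types depend on `t` and `p`.
      (λ t p → ∀ τ →
        (∀ i j (g : Γ₁ i j) → σ i j g ∙ p i ≡ cong (_∘ D₁ g) (p j) ∙ τ i j g) →
        (s , σ) ≡ (t , τ))
      (λ τ sq → cong (s ,_)
        (ext _ _ λ i → ext _ _ λ j → ext _ _ λ g →
          trans (sym (trans-reflʳ (σ i j g))) (sq i j g)))
      p τ sq

module _ {𝒞 : WildCategory o h} {𝒟 : WildCategory o′ h′}
         {L : WildFunctor 𝒞 𝒟} {R : WildFunctor 𝒟 𝒞}
         (adj : WildAdjunction L R) where

  private
    module 𝒞 = WildCategory 𝒞
    module 𝒟 = WildCategory 𝒟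
    module L = WildFunctor L
    module R = WildFunctor R
  open WildAdjunction adj

  -- Induction on `t` leaves the 2-coherence law with its inverted `L.F-∘` moved to the other side.
  coherence-square :
    Is2Coherent adj →
    ∀ {A B E X} (f : 𝒟.hom (L.F₀ E) X) (r : 𝒞.hom B E) (d : 𝒞.hom A B)
    {k : 𝒞.hom A E} (t : r 𝒞.∘ d ≡ k) →
    𝒞.assoc (ψ f) r d ∙ cong (ψ f 𝒞.∘_) t ∙ nat-dom k f
      ≡ cong (𝒞._∘ d) (nat-dom r f)
          ∙ (nat-dom d (f 𝒟.∘ L.F₁ r)
          ∙ cong ψ (𝒟.assoc f (L.F₁ r) (L.F₁ d)
                      ∙ cong (f 𝒟.∘_) (L.F-∘ r d ∙ cong L.F₁ t)))
  coherence-square coh f r d refl =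
    rearrange (𝒟.assoc f (L.F₁ r) (L.F₁ d)) (L.F-∘ r d)
      (𝒞.assoc (ψ f) r d) (nat-dom (r 𝒞.∘ d) f)
      (cong (𝒞._∘ d) (nat-dom r f)) (nat-dom d (f 𝒟.∘ L.F₁ r))
      (coh f r d)
    where
    -- The paths are abstracted to ones with free endpoints, so that most can be matched with
    -- `refl`.
    rearrange :
      ∀ {ℓ₁ ℓ₂ ℓ₃} {U : Set ℓ₁} {V : Set ℓ₂} {W : Set ℓ₃} {m : U → V} {n : V → W}
      {u u′ w x y z} (C : w ≡ m u) (φ : u ≡ u′)
      (α : x ≡ y) (β : y ≡ n (m u′)) (γ : x ≡ z) (δ : z ≡ n w) →
      α ∙ β ∙ sym (cong n (cong m φ)) ≡ γ ∙ δ ∙ cong n C →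
      α ∙ refl ∙ β ≡ γ ∙ (δ ∙ cong n (C ∙ cong m (φ ∙ refl)))
    rearrange refl refl refl β refl δ eq = trans (sym (trans-reflʳ β)) eq

  -- Once `σ`, `p` and `q` are `refl`, the common factor `nat-dom d x` cancels. What remains is an
  -- equality of paths under `cong ψ`, which is injective.
  reflect-square :
    ∀ {A B X} (d : 𝒞.hom A B) {x x′ : 𝒟.hom (L.F₀ B) X} {y y′ : 𝒟.hom (L.F₀ A) X}
    (σ : x 𝒟.∘ L.F₁ d ≡ y) (τ : x′ 𝒟.∘ L.F₁ d ≡ y′) (p : x ≡ x′) (q : y ≡ y′) →
    nat-dom d x ∙ cong ψ σ ∙ cong ψ q
      ≡ cong (𝒞._∘ d) (cong ψ p) ∙ (nat-dom d x′ ∙ cong ψ τ) →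
    σ ∙ q ≡ cong (𝒟._∘ L.F₁ d) p ∙ τ
  reflect-square d {x} refl τ refl refl eq =
    cong-to-injective (ψ-equiv _ _)
      (trans-injectiveʳ (nat-dom d x) (trans (sym (trans-reflʳ _)) eq))

  module _ {Γ : Graph v e} (F : Diagram Γ 𝒞) (X : 𝒟.Ob) where

    open Graph Γ
    open Diagram F

    transpose : LimHom (mapDiagram L F) X → LimHom F (R.F₀ X)
    transpose (s , σ) =
        (λ i → ψ (s i))
      , (λ i j g → nat-dom (D₁ g) (s j) ∙ cong ψ (σ i j g))

    transpose-injective : (∀ a b → Extensionality a b) →
                          ∀ {x y} → transpose x ≡ transpose y → x ≡ y
    transpose-injective ext {s , σ} {t , τ} eq =
      ≈⇒≡ (mapDiagram L F) ext
        ( p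
        , λ i j g →
            reflect-square (D₁ g) (σ i j g) (τ i j g) (p j) (p i)
              -- `sq` is stated for `q`; `cong-p` replaces `q` by `cong ψ` of `p` on both sides.
              (trans (cong (_ ∙_) (cong-p i))
                (trans (sq i j g)
                  (cong (λ r → cong (𝒞._∘ D₁ g) r ∙ _) (sym (cong-p j))))))
      where
      q : ∀ i → ψ (s i) ≡ ψ (t i)
      q = proj₁ (≡⇒≈ F eq)

      sq : ∀ i j (g : Γ₁ i j) →
           nat-dom (D₁ g) (s j) ∙ cong ψ (σ i j g) ∙ q i
             ≡ cong (𝒞._∘ D₁ g) (q j) ∙ (nat-dom (D₁ g) (t j) ∙ cong ψ (τ i j g))
      sq = proj₂ (≡⇒≈ F eq)

      p : ∀ i → s i ≡ t i
      p i = reflect (ψ-equiv _ _) (q i)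

      cong-p : ∀ i → cong ψ (p i) ≡ q i
      cong-p i = cong-reflect (ψ-equiv _ _) (q i)

    -- The legs agree by naturality of `ψ` in the domain, the triangles by 2-coherence.
    transpose-postcompose :
      (∀ a b → Extensionality a b) → Is2Coherent adj →
      (K : Cocone F) (f : 𝒟.hom (L.F₀ (Cocone.tip K)) X) →
      postcompose K (R.F₀ X) (ψ f) ≡ transpose (postcompose (mapCocone L K) X f)
    transpose-postcompose ext coh K f =
      ≈⇒≡ F ext
        ( (λ i → nat-dom (leg i) f)
        , (λ i j g → coherence-square coh f (leg j) (D₁ g) (tri g)))
      where open Cocone K

theorem5p4 : (∀ a b → Extensionality a b) →
    ∀ {o h o′ h′ v e : Level}
    (𝒞 : WildCategory o h) (𝒟 : WildCategory o′ h′)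
    (L : WildFunctor 𝒞 𝒟) (R : WildFunctor 𝒟 𝒞)
    (adj : WildAdjunction L R)
    (Γ : Graph v e) (F : Diagram Γ 𝒞)
    (K : Cocone F) → IsColimiting K →
    Is2Coherent adj →
    IsColimiting (mapCocone L K)
theorem5p4 ext 𝒞 𝒟 L R adj Γ F K colim coh X =
  -- A two-sided inverse is enough: `↔⇒≃` improves it to a half adjoint equivalence.
  ≃⇒isEquiv (↔⇒≃ (mk↔ₛ′ post back post-back back-post))
  where
  open WildAdjunction adj using (ψ; ψ-equiv)
  module ψ≃ = _≃_ (ψ-equiv (Cocone.tip K) X)
  module K≃ = IsEquiv (colim (WildFunctor.F₀ R X))

  post = postcompose (mapCocone L K) X
  Φ    = transpose adj F X
  comm = transpose-postcompose adj F X ext coh K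

  -- The inverse goes the other way round the square: transpose, factor through the colimit,
  -- transpose back.
  back : LimHom (mapDiagram L F) X → _
  back x = ψ≃.from (K≃.from (Φ x))

  back-post : ∀ f → back (post f) ≡ f
  back-post f = begin
    ψ≃.from (K≃.from (Φ (post f)))
      ≡⟨ cong (λ y → ψ≃.from (K≃.from y)) (comm f) ⟨
    ψ≃.from (K≃.from (postcompose K _ (ψ f)))
      ≡⟨ cong ψ≃.from (K≃.left-inverse-of (ψ f)) ⟩
    ψ≃.from (ψ f)
      ≡⟨ ψ≃.left-inverse-of f ⟩
    f ∎
    where open ≡-Reasoning

  post-back : ∀ x → post (back x) ≡ x
  post-back x = transpose-injective adj F X ext (begin
    Φ (post (back x))
      ≡⟨ comm (back x) ⟨
    postcompose K _ (ψ (back x))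
      ≡⟨ cong (postcompose K _) (ψ≃.right-inverse-of (K≃.from (Φ x))) ⟩
    postcompose K _ (K≃.from (Φ x))
      ≡⟨ K≃.right-inverse-of (Φ x) ⟩
    Φ x ∎)
    where open ≡-Reasoning
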